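{- Let $\mathscr{A}$ and $\mathscr{B}$ be two cross-intersecting Sperner families on $\mathbb{N}_n$, where $n\ge 3$ is an odd integer. Then $|\mathscr{A}|+|\mathscr{B}|=2\binom{n}{\lceil n/2\rceil}-1$ if and only if $\mathscr{A}=\binom{\mathbb{N}_n}{\lceil n/2\rceil}$, $\mathscr{B}\subset\binom{\mathbb{N}_n}{\lceil n/2\rceil}$ and $|\mathscr{B}|=\binom{n}{\lceil n/2\rceil}-1$.
   Context: For a positive integer $n$, $\mathbb{N}_n=\{1,2,\ldots,n\}$, and for $0\le k\le n$, $\binom{\mathbb{N}_n}{k}$ denotes the collection of all $k$-element subsets of $\mathbb{N}_n$. A Sperner family (or antichain) on $\mathbb{N}_n$ is a collection $\mathscr{F}$ of subsets of $\mathbb{N}_n$ such that $X\not\subseteq Y$ for all distinct $X,Y\in\mathscr{F}$. Two families $\mathscr{A},\mathscr{B}\subseteq 2^{\mathbb{N}_n}$ (where $2^{\mathbb{N}_n}$ is the power set of $\mathbb{N}_n$) are cross-intersecting if $A\cap B\neq\emptyset$ for all $A\in\mathscr{A}$ and all $B\in\mathscr{B}$.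
   Formalization: The claim is proved up to interchanging 𝒜 and ℬ: the right side is the stated condition or the same with 𝒜 and ℬ swapped. As written it fails when ℬ is the whole layer and 𝒜 is the layer minus one set. -}

module Defs where

open import Level using (0ℓ)
open import Data.Fin.Subset using (Subset; inside; outside; _⊆_; _∩_; Nonempty; ∣_∣)
open import Data.List.Base using (List; []; _∷_; _++_; map; filter; length)
open import Data.List.Membership.Propositional using () renaming (_∈_ to _∈ₗ_)
open import Data.List.Membership.Propositional.Properties
  using (∈-map⁺; ∈-map⁻; ∈-++⁺ˡ; ∈-++⁺ʳ)
open import Data.List.Relation.Unary.Any using (here)
open import Data.List.Relation.Unary.All using ([])
open import Data.List.Relation.Unary.AllPairs using ([]; _∷_)
open import Data.List.Relation.Unary.Unique.Propositional using (Unique)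
import Data.List.Relation.Unary.Unique.Propositional.Properties as Unique
open import Data.Nat.Base using (ℕ; zero; suc)
open import Data.Product.Base using (_×_; _,_)
open import Data.Vec.Base using ([]; _∷_)
open import Data.Vec.Properties using (∷-injectiveʳ)
open import Relation.Binary.PropositionalEquality using (_≡_; _≢_; refl)
open import Relation.Nullary using (¬_)
open import Relation.Unary using (Pred; Decidable; _∈_)

-- The ground set {1,…,n} is represented by Fin n. Families are compared
-- extensionally, with _≐_ and _⊂_ from Relation.Unary.
Family : ℕ → Set₁
Family n = Pred (Subset n) 0ℓ

Layer : (n k : ℕ) → Family n
Layer n k X = ∣ X ∣ ≡ k

Sperner : ∀ {n} → Family n → Set
Sperner 𝓕 = ∀ {X Y} → X ∈ 𝓕 → Y ∈ 𝓕 → X ≢ Y → ¬ (X ⊆ Y)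

CrossIntersecting : ∀ {n} → Family n → Family n → Set
CrossIntersecting 𝓐 𝓑 = ∀ {A B} → A ∈ 𝓐 → B ∈ 𝓑 → Nonempty (A ∩ B)

subsets : ∀ n → List (Subset n)
subsets zero    = [] ∷ []
subsets (suc n) = map (outside ∷_) (subsets n) ++ map (inside ∷_) (subsets n)

-- Every subset occurs in the enumeration exactly once, so that card below
-- is the cardinality of the family.
subsets-complete : ∀ {n} (X : Subset n) → X ∈ₗ subsets n
subsets-complete []            = here refl
subsets-complete (outside ∷ X) = ∈-++⁺ˡ (∈-map⁺ (outside ∷_) (subsets-complete X))
subsets-complete (inside  ∷ X) =
  ∈-++⁺ʳ (map (outside ∷_) (subsets _)) (∈-map⁺ (inside ∷_) (subsets-complete X))

subsets-unique : ∀ n → Unique (subsets n)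
subsets-unique zero    = [] ∷ []
subsets-unique (suc n) = Unique.++⁺
  (Unique.map⁺ ∷-injectiveʳ (subsets-unique n))
  (Unique.map⁺ ∷-injectiveʳ (subsets-unique n))
  disjoint
  where
  disjoint : ∀ {Z : Subset (suc n)} →
    ¬ (Z ∈ₗ map (outside ∷_) (subsets n) × Z ∈ₗ map (inside ∷_) (subsets n))
  disjoint (p , q) with ∈-map⁻ (outside ∷_) p | ∈-map⁻ (inside ∷_) q
  ... | _ , _ , refl | _ , _ , ()

-- Decidability of membership is what makes a family a finite set with a
-- definite cardinality; classically every family is decidable.
card : ∀ {n} {𝓕 : Family n} → Decidable 𝓕 → ℕ
card {n} 𝓕? = length (filter 𝓕? (subsets n))

{-# OPTIONS --safe #-}
module Submission where

-- Write n = 2m + 1 and M = C(n, m + 1). By double counting covering pairs, shadows towards the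
-- middle never shrink, so the part of an antichain P of size at least m + 1 is no larger than the
-- family D of (m + 1)-sets contained in members of P, and the part of size at most m into the
-- family U of m-sets containing members. The upper shadow of U is disjoint from D, whence
-- |P| ≤ M. Equality forces U to be closed under exchanging one element, hence U is empty or the
-- whole layer m.
-- If the sum is 2M − 1, one family, say 𝓐, has M members and the other M − 1. If U is the whole
-- layer, cross-intersection puts 𝓑 on levels above m + 1; if U is empty, 𝓐 lives on levels at
-- least m + 1. An antichain on levels at least m + 1 with some member off level m + 1 has at
-- most M − 2 members: this excludes the first case and, in the second, puts 𝓐, and then 𝓑, on
-- level m + 1.

open import Defs
open import Data.Nat using (ℕ; _+_; _*_; _∸_; _≤_; ⌈_/2⌉)
open import Data.Nat.Combinatorics using (_C_)
open import Data.Nat.Divisibility using (_∣_)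
open import Data.Product using (_×_)
open import Data.Sum using (_⊎_)
open import Function.Bundles using (_⇔_)
open import Relation.Binary.PropositionalEquality using (_≡_)
open import Relation.Nullary using (¬_)
open import Relation.Unary using (Decidable; _≐_; _⊂_)

open import Algebra.Properties.CommutativeSemigroup using (interchange; x∙yz≈y∙xz)
import Algebra.Lattice.Properties.BooleanAlgebra as BooleanAlgebraProperties
open import Data.Bool using (true; false; if_then_else_)
import Data.Bool.Properties as Bool
open import Data.Empty using (⊥-elim)
open import Data.Fin.Subset using (Subset; Nonempty; inside; outside; ∣_∣; _⊆_; ⊤)
  renaming (∁ to _ᶜ)
open import Data.Fin.Subset.Properties
  using ( anySubset?; _⊆?_; ⊆-refl; ⊆-trans; ⊆-antisym; s⊆s; out⊆; in⊆in; ∣p∣≤n; ∣⊤∣≡n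
        ; ∣∁p∣≡n∸∣p∣; p⊆q⇒∁p⊇∁q; p⊆q⇒∣p∣≤∣q∣; x∈∁p⇒x∉p; x∈p∩q⁻; ∩-comm; ∪-∩-booleanAlgebra)
open import Data.List using (List; []; _∷_; _++_; map; filter; length)
open import Data.List.Properties using (filter-++; filter-none; length-++)
import Data.List.Relation.Unary.All as All
open import Data.Nat using (zero; suc; _<_; z≤n; s≤s; NonZero; >-nonZero; _≤?_; _≟_; ⌊_/2⌋)
open import Data.Nat.Combinatorics using (nCk+nC[k+1]≡[n+1]C[k+1])
open import Data.Nat.Divisibility using (divides)
open import Data.Nat.Properties
open import Data.Product using (∃; _,_; proj₁; proj₂)
open import Data.Sum using (inj₁; inj₂)
open import Data.Vec using ([]; _∷_)
import Data.Vec.Properties as Vec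
open import Function using (_∘_; mk⇔)
open import Relation.Binary.PropositionalEquality
  using (_≢_; refl; sym; trans; cong; cong₂; subst)
open import Relation.Nullary using (Dec; yes; no; does; contradiction)
open import Relation.Nullary.Decidable using (map′; _×-dec_)
open import Relation.Unary using (_∈_; Satisfiable; _∩_) renaming (_⊆_ to _⊑_)
open import Relation.Unary.Properties using (_∩?_)

open ≤-Reasoning

private variable
  n j k u m d : ℕ
  X X′ Y : Subset n
  P Q R : Family n

-- Sums over all subsets

-- Recursion on the first coordinate mirrors `subsets`, which makes `card≡∑` an induction; double
-- counting then becomes `∑-swap`.
∑ : (Subset n → ℕ) → ℕ
∑ {zero}  f = f []
∑ {suc n} f = ∑ (f ∘ (outside ∷_)) + ∑ (f ∘ (inside ∷_))

∑-cong : {f g : Subset n → ℕ} → (∀ X → f X ≡ g X) → ∑ f ≡ ∑ g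
∑-cong {zero}  f≡g = f≡g []
∑-cong {suc n} f≡g = cong₂ _+_ (∑-cong (f≡g ∘ (outside ∷_))) (∑-cong (f≡g ∘ (inside ∷_)))

∑-mono : {f g : Subset n → ℕ} → (∀ X → f X ≤ g X) → ∑ f ≤ ∑ g
∑-mono {zero}  f≤g = f≤g []
∑-mono {suc n} f≤g = +-mono-≤ (∑-mono (f≤g ∘ (outside ∷_))) (∑-mono (f≤g ∘ (inside ∷_)))

∑-zero : ∀ n → ∑ {n} (λ _ → 0) ≡ 0
∑-zero zero    = refl
∑-zero (suc n) = cong₂ _+_ (∑-zero n) (∑-zero n)

∑-+ : (f g : Subset n → ℕ) → ∑ (λ X → f X + g X) ≡ ∑ f + ∑ g
∑-+ {zero}  f g = refl
∑-+ {suc n} f g = trans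
  (cong₂ _+_ (∑-+ (f ∘ (outside ∷_)) (g ∘ (outside ∷_))) (∑-+ (f ∘ (inside ∷_)) (g ∘ (inside ∷_))))
  (interchange +-commutativeSemigroup (∑ (f ∘ (outside ∷_))) _ _ _)

∑-*ˡ : ∀ c (f : Subset n → ℕ) → ∑ (λ X → c * f X) ≡ c * ∑ f
∑-*ˡ {zero}  c f = refl
∑-*ˡ {suc n} c f = trans
  (cong₂ _+_ (∑-*ˡ c (f ∘ (outside ∷_))) (∑-*ˡ c (f ∘ (inside ∷_))))
  (sym (*-distribˡ-+ c (∑ (f ∘ (outside ∷_))) _))

∑-*ʳ : ∀ c (f : Subset n → ℕ) → ∑ (λ X → f X * c) ≡ ∑ f * c
∑-*ʳ c f = trans (∑-cong (λ X → *-comm (f X) c)) (trans (∑-*ˡ c f) (*-comm c (∑ f)))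

∑-swap : (f : Subset n → Subset m → ℕ) → ∑ (λ X → ∑ (f X)) ≡ ∑ (λ Y → ∑ (λ X → f X Y))
∑-swap {zero}  f = refl
∑-swap {suc n} f = trans
  (cong₂ _+_ (∑-swap (f ∘ (outside ∷_))) (∑-swap (f ∘ (inside ∷_))))
  (sym (∑-+ (λ Y → ∑ (λ X → f (outside ∷ X) Y)) _))

∑-ᶜ : (f : Subset n → ℕ) → ∑ (f ∘ _ᶜ) ≡ ∑ f
∑-ᶜ {zero}  f = refl
∑-ᶜ {suc n} f = trans
  (cong₂ _+_ (∑-ᶜ (f ∘ (inside ∷_))) (∑-ᶜ (f ∘ (outside ∷_))))
  (+-comm (∑ (f ∘ (inside ∷_))) _)

squeeze : ∀ {a b c d} → a ≤ c → b ≤ d → c + d ≤ a + b → c ≤ a × d ≤ b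
squeeze {a} {b} {c} {d} a≤c b≤d cd≤ab =
  +-cancelʳ-≤ b c a (≤-trans (+-monoʳ-≤ c b≤d) cd≤ab) ,
  +-cancelˡ-≤ a d b (≤-trans (+-monoˡ-≤ d a≤c) cd≤ab)

-- Turns tightness of a global count into information at every single set.
∑-squeeze : {f g : Subset n → ℕ} → (∀ X → f X ≤ g X) → ∑ g ≤ ∑ f → ∀ X → g X ≤ f X
∑-squeeze f≤g ∑g≤∑f []            = ∑g≤∑f
∑-squeeze f≤g ∑g≤∑f (s ∷ X)
  with out , ins ← squeeze (∑-mono (f≤g ∘ (outside ∷_))) (∑-mono (f≤g ∘ (inside ∷_))) ∑g≤∑f
  with s
... | outside = ∑-squeeze (f≤g ∘ (outside ∷_)) out X
... | inside  = ∑-squeeze (f≤g ∘ (inside ∷_)) ins X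

-- Indicators and cardinalities

⟦_⟧ : {A : Set} → Dec A → ℕ
⟦ a? ⟧ = if does a? then 1 else 0

⟦⟧-true : {A : Set} (a? : Dec A) → A → ⟦ a? ⟧ ≡ 1
⟦⟧-true (yes _) _ = refl
⟦⟧-true (no ¬a) a = contradiction a ¬a

⟦⟧-false : {A : Set} (a? : Dec A) → ¬ A → ⟦ a? ⟧ ≡ 0
⟦⟧-false (yes a) ¬a = contradiction a ¬a
⟦⟧-false (no _)  _  = refl

⟦⟧-mono : {A B : Set} (a? : Dec A) (b? : Dec B) → (A → B) → ⟦ a? ⟧ ≤ ⟦ b? ⟧
⟦⟧-mono (no _)  b? a→b = z≤n
⟦⟧-mono (yes a) b? a→b = ≤-reflexive (sym (⟦⟧-true b? (a→b a)))

⟦⟧-reflect : {A B : Set} (a? : Dec A) (b? : Dec B) → ⟦ a? ⟧ ≤ ⟦ b? ⟧ → A → B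
⟦⟧-reflect (yes _) (yes b) _ _ = b
⟦⟧-reflect (no ¬a) _       _ a = contradiction a ¬a

length-filter-map : {A B : Set} {P : B → Set} (P? : Decidable P) (f : A → B) (xs : List A) →
  length (filter P? (map f xs)) ≡ length (filter (P? ∘ f) xs)
length-filter-map P? f []       = refl
length-filter-map P? f (x ∷ xs) with does (P? (f x))
... | true  = cong suc (length-filter-map P? f xs)
... | false = length-filter-map P? f xs

card≡∑ : (P? : Decidable P) → card P? ≡ ∑ (λ X → ⟦ P? X ⟧)
card≡∑ {zero} P? with does (P? [])
... | true  = refl
... | false = refl
card≡∑ {suc n} P? = begin-equality
  length (filter P? (outs ++ ins))                    ≡⟨ cong length (filter-++ P? outs ins) ⟩
  length (filter P? outs ++ filter P? ins)            ≡⟨ length-++ (filter P? outs) ⟩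
  length (filter P? outs) + length (filter P? ins)
    ≡⟨ cong₂ _+_ (length-filter-map P? (outside ∷_) (subsets n)) (length-filter-map P? (inside ∷_) (subsets n)) ⟩
  card (P? ∘ (outside ∷_)) + card (P? ∘ (inside ∷_))  ≡⟨ cong₂ _+_ (card≡∑ (P? ∘ (outside ∷_))) (card≡∑ (P? ∘ (inside ∷_))) ⟩
  ∑ (λ X → ⟦ P? X ⟧)                                  ∎
  where
  outs ins : List (Subset (suc n))
  outs = map (outside ∷_) (subsets n)
  ins  = map (inside ∷_) (subsets n)

card-mono : (P? : Decidable P) (Q? : Decidable Q) → P ⊑ Q → card P? ≤ card Q?
card-mono P? Q? P⊑Q rewrite card≡∑ P? | card≡∑ Q? = ∑-mono (λ X → ⟦⟧-mono (P? X) (Q? X) P⊑Q)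

card-squeeze : (P? : Decidable P) (Q? : Decidable Q) → P ⊑ Q → card Q? ≤ card P? → Q ⊑ P
card-squeeze P? Q? P⊑Q Q≤P {X} rewrite card≡∑ P? | card≡∑ Q? =
  ⟦⟧-reflect (Q? X) (P? X) (∑-squeeze (λ Z → ⟦⟧-mono (P? Z) (Q? Z) P⊑Q) Q≤P X)

card-cover : (R? : Decidable R) (P? : Decidable P) (Q? : Decidable Q) →
  (∀ {X} → X ∈ R → X ∈ P ⊎ X ∈ Q) → card R? ≤ card P? + card Q?
card-cover R? P? Q? R⊑P∪Q rewrite card≡∑ R? | card≡∑ P? | card≡∑ Q? = begin
  ∑ (λ X → ⟦ R? X ⟧)                       ≤⟨ ∑-mono pointwise ⟩
  ∑ (λ X → ⟦ P? X ⟧ + ⟦ Q? X ⟧)            ≡⟨ ∑-+ (λ X → ⟦ P? X ⟧) _ ⟩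
  ∑ (λ X → ⟦ P? X ⟧) + ∑ (λ X → ⟦ Q? X ⟧)  ∎
  where
  pointwise : ∀ X → ⟦ R? X ⟧ ≤ ⟦ P? X ⟧ + ⟦ Q? X ⟧
  pointwise X with R? X
  ... | no _  = z≤n
  ... | yes r with R⊑P∪Q r
  ...   | inj₁ p = m≤n⇒m≤n+o _ (≤-reflexive (sym (⟦⟧-true (P? X) p)))
  ...   | inj₂ q = m≤n⇒m≤o+n _ (≤-reflexive (sym (⟦⟧-true (Q? X) q)))

card-disjoint : (P? : Decidable P) (Q? : Decidable Q) (R? : Decidable R) →
  (∀ {X} → X ∈ P → ¬ X ∈ Q) → P ⊑ R → Q ⊑ R → card P? + card Q? ≤ card R?
card-disjoint P? Q? R? disjoint P⊑R Q⊑R rewrite card≡∑ R? | card≡∑ P? | card≡∑ Q? = begin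
  ∑ (λ X → ⟦ P? X ⟧) + ∑ (λ X → ⟦ Q? X ⟧)  ≡⟨ ∑-+ (λ X → ⟦ P? X ⟧) _ ⟨
  ∑ (λ X → ⟦ P? X ⟧ + ⟦ Q? X ⟧)            ≤⟨ ∑-mono pointwise ⟩
  ∑ (λ X → ⟦ R? X ⟧)                       ∎
  where
  pointwise : ∀ X → ⟦ P? X ⟧ + ⟦ Q? X ⟧ ≤ ⟦ R? X ⟧
  pointwise X with P? X
  ... | no _  = ⟦⟧-mono (Q? X) (R? X) Q⊑R
  ... | yes p rewrite ⟦⟧-false (Q? X) (disjoint p) = ≤-reflexive (sym (⟦⟧-true (R? X) (P⊑R p)))

card-ᶜ : (P? : Decidable P) → card (P? ∘ _ᶜ) ≡ card P?
card-ᶜ P? = trans (card≡∑ (P? ∘ _ᶜ)) (trans (∑-ᶜ (λ X → ⟦ P? X ⟧)) (sym (card≡∑ P?)))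

card-∅ : (P? : Decidable P) → (∀ X → ¬ X ∈ P) → card P? ≡ 0
card-∅ {n} P? empty = cong length (filter-none P? (All.universal empty (subsets n)))

Layer? : ∀ n k → Decidable (Layer n k)
Layer? n k X = ∣ X ∣ ≟ k

card-Layer : ∀ n k → card (Layer? n k) ≡ n C k
card-Layer n k = trans (card≡∑ (Layer? n k)) (∑-layer n k)
  where
  ∑-layer : ∀ n k → ∑ (λ X → ⟦ Layer? n k X ⟧) ≡ n C k
  ∑-layer zero    zero    = refl
  ∑-layer zero    (suc k) = refl
  ∑-layer (suc n) zero    = trans (cong₂ _+_ (∑-layer n 0) (∑-zero n)) (+-identityʳ (n C 0))
  ∑-layer (suc n) (suc k) = begin-equality
    ∑ (λ X → ⟦ Layer? n (suc k) X ⟧) + ∑ (λ X → ⟦ Layer? n k X ⟧)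
                       ≡⟨ cong₂ _+_ (∑-layer n (suc k)) (∑-layer n k) ⟩
    n C suc k + n C k  ≡⟨ +-comm (n C suc k) (n C k) ⟩
    n C k + n C suc k  ≡⟨ nCk+nC[k+1]≡[n+1]C[k+1] n k ⟩
    suc n C suc k      ∎

-- The covering relation

infix 4 _⋖_ _⋖?_

-- `here` marks the one coordinate that is switched on. The recursion matches that of `∑`, so the
-- degree counts below are structural.
data _⋖_ : Subset n → Subset n → Set where
  here  : (outside ∷ X) ⋖ (inside ∷ X)
  there : ∀ {s} → X ⋖ Y → (s ∷ X) ⋖ (s ∷ Y)

⋖⇒⊆ : X ⋖ Y → X ⊆ Y
⋖⇒⊆ here      = out⊆ ⊆-refl
⋖⇒⊆ (there c) = s⊆s (⋖⇒⊆ c)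

⋖⇒∣∣ : X ⋖ Y → ∣ Y ∣ ≡ suc ∣ X ∣
⋖⇒∣∣ here                  = refl
⋖⇒∣∣ (there {s = outside} c) = ⋖⇒∣∣ c
⋖⇒∣∣ (there {s = inside}  c) = cong suc (⋖⇒∣∣ c)

_≟ˢ_ : (X Y : Subset n) → Dec (X ≡ Y)
_≟ˢ_ = Vec.≡-dec Bool._≟_

_⋖?_ : (X Y : Subset n) → Dec (X ⋖ Y)
[]            ⋖? []            = no λ ()
(outside ∷ X) ⋖? (outside ∷ Y) = map′ there (λ { (there c) → c }) (X ⋖? Y)
(outside ∷ X) ⋖? (inside  ∷ Y) = map′ (λ { refl → here }) (λ { here → refl }) (X ≟ˢ Y)
(inside  ∷ X) ⋖? (outside ∷ Y) = no λ ()
(inside  ∷ X) ⋖? (inside  ∷ Y) = map′ there (λ { (there c) → c }) (X ⋖? Y)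

∑-≟ˡ : (X : Subset n) → ∑ (λ Y → ⟦ X ≟ˢ Y ⟧) ≡ 1
∑-≟ˡ []            = refl
∑-≟ˡ {suc n} (outside ∷ X) = cong₂ _+_ (∑-≟ˡ X) (∑-zero n)
∑-≟ˡ {suc n} (inside  ∷ X) = cong₂ _+_ (∑-zero n) (∑-≟ˡ X)

∑-≟ʳ : (Y : Subset n) → ∑ (λ X → ⟦ X ≟ˢ Y ⟧) ≡ 1
∑-≟ʳ []            = refl
∑-≟ʳ {suc n} (outside ∷ Y) = cong₂ _+_ (∑-≟ʳ Y) (∑-zero n)
∑-≟ʳ {suc n} (inside  ∷ Y) = cong₂ _+_ (∑-zero n) (∑-≟ʳ Y)

down-degree : (Y : Subset n) → ∑ (λ X → ⟦ X ⋖? Y ⟧) ≡ ∣ Y ∣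
down-degree []            = refl
down-degree {suc n} (outside ∷ Y) = trans (cong₂ _+_ (down-degree Y) (∑-zero n)) (+-identityʳ ∣ Y ∣)
down-degree {suc n} (inside  ∷ Y) = cong₂ _+_ (∑-≟ʳ Y) (down-degree Y)

-- The additive form avoids the truncated difference `n ∸ ∣ X ∣`.
up-degree : (X : Subset n) → ∣ X ∣ + ∑ (λ Y → ⟦ X ⋖? Y ⟧) ≡ n
up-degree []            = refl
up-degree {suc n} (outside ∷ X) = begin-equality
  ∣ X ∣ + (∑ (λ Y → ⟦ X ⋖? Y ⟧) + ∑ (λ Y → ⟦ X ≟ˢ Y ⟧))  ≡⟨ +-assoc ∣ X ∣ _ _ ⟨
  ∣ X ∣ + ∑ (λ Y → ⟦ X ⋖? Y ⟧) + ∑ (λ Y → ⟦ X ≟ˢ Y ⟧)    ≡⟨ cong₂ _+_ (up-degree X) (∑-≟ˡ X) ⟩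
  n + 1                                                  ≡⟨ +-comm n 1 ⟩
  suc n                                                  ∎
up-degree {suc n} (inside ∷ X) = cong suc
  (trans (cong (λ z → ∣ X ∣ + (z + ∑ (λ Y → ⟦ X ⋖? Y ⟧))) (∑-zero n))
         (up-degree X))

lower-cover : (X : Subset n) → 0 < ∣ X ∣ → ∃ λ Z → Z ⋖ X
lower-cover (outside ∷ X) 0<∣X∣ with Z , c ← lower-cover X 0<∣X∣ = outside ∷ Z , there c
lower-cover (inside  ∷ X) _     = outside ∷ X , here

upper-cover : (X : Subset n) → ∣ X ∣ < n → ∃ λ Z → X ⋖ Z
upper-cover (outside ∷ X) _           = inside ∷ X , here
upper-cover (inside  ∷ X) (s≤s ∣X∣<n) with Z , c ← upper-cover X ∣X∣<n = inside ∷ Z , there c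

subset-of-size : (X : Subset n) → k ≤ ∣ X ∣ → ∃ λ Z → Z ⊆ X × ∣ Z ∣ ≡ k
subset-of-size {k = zero} [] _ = [] , ⊆-refl , refl
subset-of-size (outside ∷ X) k≤ with Z , Z⊆X , eq ← subset-of-size X k≤ = outside ∷ Z , s⊆s Z⊆X , eq
subset-of-size {k = zero} (inside ∷ X) _ with Z , Z⊆X , eq ← subset-of-size {k = zero} X z≤n = outside ∷ Z , out⊆ Z⊆X , eq
subset-of-size {k = suc k} (inside ∷ X) (s≤s k≤) with Z , Z⊆X , eq ← subset-of-size X k≤ = inside ∷ Z , in⊆in Z⊆X , cong suc eq

-- Sets of equal size are linked by exchanges of one element. Where the first coordinates differ,
-- one exchange through a common upper cover makes them agree, with any lower or upper cover of the
-- tail absorbing the change; the induction continues in the tails.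
swap-connected : (P : Family n) → (∀ {X X′ Y} → X ∈ P → X ⋖ Y → X′ ⋖ Y → X′ ∈ P) →
  ∀ X X′ → ∣ X ∣ ≡ ∣ X′ ∣ → X ∈ P → X′ ∈ P
swap-connected P closed [] [] _ p = p
swap-connected P closed (outside ∷ X) (outside ∷ X′) eq p =
  swap-connected (P ∘ (outside ∷_)) (λ q c c′ → closed q (there c) (there c′)) X X′ eq p
swap-connected P closed (inside ∷ X) (inside ∷ X′) eq p =
  swap-connected (P ∘ (inside ∷_)) (λ q c c′ → closed q (there c) (there c′)) X X′ (suc-injective eq) p
swap-connected P closed (outside ∷ X) (inside ∷ X′) eq p
  with Z , c ← lower-cover X (subst (0 <_) (sym eq) (s≤s z≤n)) =
  swap-connected (P ∘ (inside ∷_)) (λ q c₁ c₂ → closed q (there c₁) (there c₂)) Z X′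
    (suc-injective (trans (sym (⋖⇒∣∣ c)) eq)) (closed p here (there c))
swap-connected {suc n} P closed (inside ∷ X) (outside ∷ X′) eq p
  with Z , c ← upper-cover X (subst (_≤ n) (sym eq) (∣p∣≤n X′)) =
  swap-connected (P ∘ (outside ∷_)) (λ q c₁ c₂ → closed q (there c₁) (there c₂)) Z X′
    (trans (⋖⇒∣∣ c) eq) (closed p (there c) here)

-- Shadows

∂ ∇ : Family n → Family n
∂ P X = ∃ λ Y → Y ∈ P × X ⋖ Y
∇ P Y = ∃ λ X → X ∈ P × X ⋖ Y

∂? : Decidable P → Decidable (∂ P)
∂? P? X = anySubset? (λ Y → P? Y ×-dec X ⋖? Y)

∇? : Decidable P → Decidable (∇ P)
∇? P? Y = anySubset? (λ X → P? X ×-dec X ⋖? Y)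

∑-regular : (P? : Decidable P) (f : Subset n → ℕ) → (∀ {X} → X ∈ P → f X ≡ d) →
  ∑ (λ X → ⟦ P? X ⟧ * f X) ≡ card P? * d
∑-regular {d = d} P? f regular = begin-equality
  ∑ (λ X → ⟦ P? X ⟧ * f X)  ≡⟨ ∑-cong pointwise ⟩
  ∑ (λ X → ⟦ P? X ⟧ * d)    ≡⟨ ∑-*ʳ d (λ X → ⟦ P? X ⟧) ⟩
  ∑ (λ X → ⟦ P? X ⟧) * d    ≡⟨ cong (_* d) (card≡∑ P?) ⟨
  card P? * d               ∎
  where
  pointwise : ∀ X → ⟦ P? X ⟧ * f X ≡ ⟦ P? X ⟧ * d
  pointwise X with P? X
  ... | yes p = cong (1 *_) (regular p)
  ... | no _  = refl

-- Double counting of covering edges. Every such sum has the lower endpoint outside and the upper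
-- endpoint inside, so that counts from either end can be compared edge by edge.
edges-from-below : (P? : Decidable P) → j + u ≡ n → P ⊑ Layer n j →
  ∑ (λ X → ∑ (λ Y → ⟦ P? X ⟧ * ⟦ X ⋖? Y ⟧)) ≡ card P? * u
edges-from-below {P = P} {j = j} {u = u} P? j+u≡n P⊑Layer = trans
  (∑-cong (λ X → ∑-*ˡ ⟦ P? X ⟧ (λ Y → ⟦ X ⋖? Y ⟧)))
  (∑-regular P? (λ X → ∑ (λ Y → ⟦ X ⋖? Y ⟧)) degree)
  where
  degree : ∀ {X} → X ∈ P → ∑ (λ Y → ⟦ X ⋖? Y ⟧) ≡ u
  degree {X} p = +-cancelˡ-≡ j _ _
    (trans (cong (_+ ∑ (λ Y → ⟦ X ⋖? Y ⟧)) (sym (P⊑Layer p))) (trans (up-degree X) (sym j+u≡n)))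

edges-from-above : (P? : Decidable P) → P ⊑ Layer n j →
  ∑ (λ X → ∑ (λ Y → ⟦ P? Y ⟧ * ⟦ X ⋖? Y ⟧)) ≡ card P? * j
edges-from-above P? P⊑Layer = trans
  (∑-swap (λ X Y → ⟦ P? Y ⟧ * ⟦ X ⋖? Y ⟧))
  (trans
    (∑-cong (λ Y → ∑-*ˡ ⟦ P? Y ⟧ (λ X → ⟦ X ⋖? Y ⟧)))
    (∑-regular P? (λ Y → ∑ (λ X → ⟦ X ⋖? Y ⟧)) (λ {Y} p → trans (down-degree Y) (P⊑Layer p))))

∂-layer : P ⊑ Layer n (suc j) → ∂ P ⊑ Layer n j
∂-layer P⊑Layer (Y , p , c) = suc-injective (trans (sym (⋖⇒∣∣ c)) (P⊑Layer p))

∇-layer : P ⊑ Layer n j → ∇ P ⊑ Layer n (suc j)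
∇-layer P⊑Layer (X , p , c) = trans (⋖⇒∣∣ c) (cong suc (P⊑Layer p))

edge-mono : {A B C : Set} (a? : Dec A) (b? : Dec B) (c? : Dec C) → (A → C → B) →
  ⟦ a? ⟧ * ⟦ c? ⟧ ≤ ⟦ b? ⟧ * ⟦ c? ⟧
edge-mono a? b? (yes c) a→c→b = *-monoˡ-≤ 1 (⟦⟧-mono a? b? (λ a → a→c→b a c))
edge-mono a? b? (no _)  a→c→b rewrite *-zeroʳ ⟦ a? ⟧ = z≤n

-- Each edge going down from `P` ends in the shadow. A member has `suc j` such edges, and a set of
-- the shadow has `u` edges going up.
local-LYM : (P? : Decidable P) → j + u ≡ n → P ⊑ Layer n (suc j) → card P? * suc j ≤ card (∂? P?) * u
local-LYM {j = j} {u = u} P? j+u≡n P⊑Layer = begin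
  card P? * suc j                                   ≡⟨ edges-from-above P? P⊑Layer ⟨
  ∑ (λ X → ∑ (λ Y → ⟦ P? Y ⟧ * ⟦ X ⋖? Y ⟧))
    ≤⟨ ∑-mono (λ X → ∑-mono (λ Y → edge-mono (P? Y) (∂? P? X) (X ⋖? Y) (λ p c → Y , p , c))) ⟩
  ∑ (λ X → ∑ (λ Y → ⟦ ∂? P? X ⟧ * ⟦ X ⋖? Y ⟧))      ≡⟨ edges-from-below (∂? P?) j+u≡n (∂-layer P⊑Layer) ⟩
  card (∂? P?) * u                                  ∎

-- With `u ≤ suc j`, a set of the shadow has at most as many upper covers as a member has lower
-- covers, so the factor cancels from `local-LYM`.
∂-grows : (P? : Decidable P) → j + u ≡ n → u ≤ suc j → P ⊑ Layer n (suc j) → card P? ≤ card (∂? P?)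
∂-grows {j = j} P? j+u≡n u≤1+j P⊑Layer = *-cancelʳ-≤ _ _ (suc j)
  (≤-trans (local-LYM P? j+u≡n P⊑Layer) (*-monoʳ-≤ (card (∂? P?)) u≤1+j))

∂-large : (P? : Decidable P) → Y ∈ P → ∣ Y ∣ ≤ card (∂? P?)
∂-large {Y = Y} P? p = begin
  ∣ Y ∣                   ≡⟨ down-degree Y ⟨
  ∑ (λ X → ⟦ X ⋖? Y ⟧)    ≤⟨ ∑-mono (λ X → ⟦⟧-mono (X ⋖? Y) (∂? P? X) (λ c → Y , p , c)) ⟩
  ∑ (λ X → ⟦ ∂? P? X ⟧)   ≡⟨ card≡∑ (∂? P?) ⟨
  card (∂? P?)            ∎

-- A family of more than m sets gains 2 by the local LYM inequality, a smaller one because the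
-- shadow of a single member already has m + 2 elements.
∂-gains-2 : .{{_ : NonZero m}} (P? : Decidable P) → suc m + m ≡ n → P ⊑ Layer n (2 + m) → ∃⟨ P ⟩ →
  2 + card P? ≤ card (∂? P?)
∂-gains-2 {m = m} P? 2m+1≡n P⊑Layer (Y , p) with card P? ≤? m
... | yes P≤m = begin
  2 + card P?   ≤⟨ +-monoʳ-≤ 2 P≤m ⟩
  2 + m         ≡⟨ P⊑Layer p ⟨
  ∣ Y ∣         ≤⟨ ∂-large P? p ⟩
  card (∂? P?)  ∎
... | no P≰m = *-cancelʳ-≤ _ _ m (begin
  (2 + card P?) * m          ≡⟨ *-distribʳ-+ m 2 (card P?) ⟩
  2 * m + card P? * m        ≤⟨ +-monoˡ-≤ _ (*-monoʳ-≤ 2 (≰⇒≥ P≰m)) ⟩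
  2 * card P? + card P? * m  ≡⟨ cong (_+ card P? * m) (*-comm 2 (card P?)) ⟩
  card P? * 2 + card P? * m  ≡⟨ *-distribˡ-+ (card P?) 2 m ⟨
  card P? * (2 + m)          ≤⟨ local-LYM P? 2m+1≡n P⊑Layer ⟩
  card (∂? P?) * m           ∎)

edges-below≤above : (P? : Decidable P) → ∀ X Y → ⟦ P? X ⟧ * ⟦ X ⋖? Y ⟧ ≤ ⟦ ∇? P? Y ⟧ * ⟦ X ⋖? Y ⟧
edges-below≤above P? X Y = edge-mono (P? X) (∇? P? Y) (X ⋖? Y) (λ p c → X , p , c)

-- Between the two middle levels the covering graph is regular: both degrees are `suc j`.
∇-grows : (P? : Decidable P) → j + suc j ≡ n → P ⊑ Layer n j → card P? ≤ card (∇? P?)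
∇-grows {j = j} P? 2j+1≡n P⊑Layer = *-cancelʳ-≤ _ _ (suc j) (begin
  card P? * suc j                               ≡⟨ edges-from-below P? 2j+1≡n P⊑Layer ⟨
  ∑ (λ X → ∑ (λ Y → ⟦ P? X ⟧ * ⟦ X ⋖? Y ⟧))     ≤⟨ ∑-mono (λ X → ∑-mono (edges-below≤above P? X)) ⟩
  ∑ (λ X → ∑ (λ Y → ⟦ ∇? P? Y ⟧ * ⟦ X ⋖? Y ⟧))  ≡⟨ edges-from-above (∇? P?) (∇-layer P⊑Layer) ⟩
  card (∇? P?) * suc j                          ∎)

-- If the upper shadow does not grow, double counting leaves no edge from it to a set outside P.
∇-tight⇒closed : (P? : Decidable P) → j + suc j ≡ n → P ⊑ Layer n j → card (∇? P?) ≤ card P? →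
  X ∈ P → X ⋖ Y → X′ ⋖ Y → X′ ∈ P
∇-tight⇒closed {j = j} {X = X} {Y = Y} {X′ = X′} P? 2j+1≡n P⊑Layer ∇≤P p c c′ =
  ⟦⟧-reflect (∇? P? Y) (P? X′) (*-cancelʳ-≤ _ _ 1 unscaled) (X , p , c)
  where
  tight : ∑ (λ X → ∑ (λ Y → ⟦ ∇? P? Y ⟧ * ⟦ X ⋖? Y ⟧)) ≤ ∑ (λ X → ∑ (λ Y → ⟦ P? X ⟧ * ⟦ X ⋖? Y ⟧))
  tight = begin
    ∑ (λ X → ∑ (λ Y → ⟦ ∇? P? Y ⟧ * ⟦ X ⋖? Y ⟧))  ≡⟨ edges-from-above (∇? P?) (∇-layer P⊑Layer) ⟩
    card (∇? P?) * suc j                          ≤⟨ *-monoˡ-≤ (suc j) ∇≤P ⟩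
    card P? * suc j                               ≡⟨ edges-from-below P? 2j+1≡n P⊑Layer ⟨
    ∑ (λ X → ∑ (λ Y → ⟦ P? X ⟧ * ⟦ X ⋖? Y ⟧))     ∎

  pointwise : ⟦ ∇? P? Y ⟧ * ⟦ X′ ⋖? Y ⟧ ≤ ⟦ P? X′ ⟧ * ⟦ X′ ⋖? Y ⟧
  pointwise = ∑-squeeze (edges-below≤above P? X′)
    (∑-squeeze (λ Z → ∑-mono (edges-below≤above P? Z)) tight X′) Y

  unscaled : ⟦ ∇? P? Y ⟧ * 1 ≤ ⟦ P? X′ ⟧ * 1
  unscaled = subst (λ e → ⟦ ∇? P? Y ⟧ * e ≤ ⟦ P? X′ ⟧ * e) (⟦⟧-true (X′ ⋖? Y) c′) pointwise

-- Antichains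

-- Only members of size at least `j` contribute: this is the upper part of `P` pushed down to level
-- `j`.
Down : Family n → ℕ → Family n
Down P j X = ∣ X ∣ ≡ j × ∃ λ Y → Y ∈ P × X ⊆ Y

Down? : Decidable P → ∀ j → Decidable (Down P j)
Down? P? j X = ∣ X ∣ ≟ j ×-dec anySubset? (λ Y → P? Y ×-dec X ⊆? Y)

AtLeast AtMost : ∀ n → ℕ → Family n
AtLeast n j X = j ≤ ∣ X ∣
AtMost  n j X = ∣ X ∣ ≤ j

AtLeast? : ∀ n j → Decidable (AtLeast n j)
AtLeast? n j X = j ≤? ∣ X ∣

AtMost? : ∀ n j → Decidable (AtMost n j)
AtMost? n j X = ∣ X ∣ ≤? j

Sperner⇒≡ : Sperner P → X ∈ P → Y ∈ P → X ⊆ Y → X ≡ Y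
Sperner⇒≡ {X = X} {Y = Y} sperner x y X⊆Y with X ≟ˢ Y
... | yes X≡Y = X≡Y
... | no X≢Y  = ⊥-elim (sperner x y X≢Y X⊆Y)

∂Down⊑Down : ∂ (Down P (suc j)) ⊑ Down P j
∂Down⊑Down (Z , (∣Z∣ , Y , y , Z⊆Y) , c) =
  suc-injective (trans (sym (⋖⇒∣∣ c)) ∣Z∣) , Y , y , ⊆-trans (⋖⇒⊆ c) Z⊆Y

-- Otherwise `X` would be a proper subset of a member, with a set of size `suc j` in between.
∂Down-disjoint : Sperner P → X ∈ P → ¬ X ∈ ∂ (Down P (suc j))
∂Down-disjoint sperner x (Z , (_ , Y , y , Z⊆Y) , c)
  with refl ← Sperner⇒≡ sperner x y (⊆-trans (⋖⇒⊆ c) Z⊆Y)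
  with refl ← ⊆-antisym (⋖⇒⊆ c) Z⊆Y = 1+n≢n (sym (⋖⇒∣∣ c))

layer+∂Down≤Down : (P? : Decidable P) → Sperner P →
  card (P? ∩? Layer? n j) + card (∂? (Down? P? (suc j))) ≤ card (Down? P? j)
layer+∂Down≤Down P? sperner = card-disjoint (P? ∩? Layer? _ _) (∂? (Down? P? _)) (Down? P? _)
  (λ (x , _) → ∂Down-disjoint sperner x) (λ {X} (x , ∣X∣) → ∣X∣ , X , x , ⊆-refl) ∂Down⊑Down

AtLeast-split : (P? : Decidable P) →
  card (P? ∩? AtLeast? n j) ≤ card (P? ∩? Layer? n j) + card (P? ∩? AtLeast? n (suc j))
AtLeast-split {P = P} {j = j} P? = card-cover (P? ∩? AtLeast? _ j) (P? ∩? Layer? _ j) (P? ∩? AtLeast? _ (suc j)) split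
  where
  split : ∀ {X} → X ∈ P ∩ AtLeast _ j → X ∈ P ∩ Layer _ j ⊎ X ∈ P ∩ AtLeast _ (suc j)
  split (x , j≤∣X∣) with m≤n⇒m<n∨m≡n j≤∣X∣
  ... | inj₁ j<∣X∣ = inj₂ (x , j<∣X∣)
  ... | inj₂ j≡∣X∣ = inj₁ (x , sym j≡∣X∣)

-- Replacing the top level of an antichain by its shadow keeps it an antichain and, at or above
-- the middle, does not shrink it; iterating pushes everything down to level j.
AtLeast≤Down : ∀ j u → j + u ≡ n → u ≤ suc j → (P? : Decidable P) → Sperner P →
  card (P? ∩? AtLeast? n j) ≤ card (Down? P? j)
-- `u` counts the levels above `j`; at zero, level `j` is the top one and nothing has to be pushed.
AtLeast≤Down {n} j zero j+0≡n _ P? sperner = card-mono (P? ∩? AtLeast? n j) (Down? P? j)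
  (λ {X} (x , j≤∣X∣) → ≤-antisym (subst (∣ X ∣ ≤_) (trans (sym j+0≡n) (+-identityʳ j)) (∣p∣≤n X)) j≤∣X∣ , X , x , ⊆-refl)
AtLeast≤Down {n} j (suc u) j+u≡n u≤j P? sperner = begin
  card (P? ∩? AtLeast? n j)                                    ≤⟨ AtLeast-split P? ⟩
  card (P? ∩? Layer? n j) + card (P? ∩? AtLeast? n (suc j))
    ≤⟨ +-monoʳ-≤ _ (AtLeast≤Down (suc j) u (trans (sym (+-suc j u)) j+u≡n) (m≤n⇒m≤1+n (<⇒≤ u≤j)) P? sperner) ⟩
  card (P? ∩? Layer? n j) + card (Down? P? (suc j))            ≤⟨ +-monoʳ-≤ _ (∂-grows (Down? P? (suc j)) j+u≡n u≤j proj₁) ⟩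
  card (P? ∩? Layer? n j) + card (∂? (Down? P? (suc j)))       ≤⟨ layer+∂Down≤Down P? sperner ⟩
  card (Down? P? j)                                            ∎

-- A member above level `suc m` makes the pushed-down family on level `2 + m` nonempty, so the last
-- shadow step gains 2 by `∂-gains-2`.
upper-half-gap : .{{_ : NonZero m}} → suc m + m ≡ n → (P? : Decidable P) → Sperner P →
  P ⊑ AtLeast n (suc m) → X ∈ P → ∣ X ∣ ≢ suc m → 2 + card P? ≤ n C suc m
upper-half-gap {m = m@(suc m-1)} {n = n} {P = P} {X = X} 2m+1≡n P? sperner P⊑AtLeast x ∣X∣≢ = begin
  2 + card P?
    ≤⟨ +-monoʳ-≤ 2 (card-mono P? (P? ∩? AtLeast? n (suc m)) (λ y → y , P⊑AtLeast y)) ⟩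
  2 + card (P? ∩? AtLeast? n (suc m))                                ≤⟨ +-monoʳ-≤ 2 (AtLeast-split P?) ⟩
  2 + (card (P? ∩? Layer? n (suc m)) + card (P? ∩? AtLeast? n (2 + m)))
    ≤⟨ +-monoʳ-≤ 2 (+-monoʳ-≤ (card (P? ∩? Layer? n (suc m)))
         -- There are `m-1` levels above `2 + m`; the side condition is `m-1 ≤ 3 + m`, and `3 + m`
         -- is `4 + m-1`.
         (AtLeast≤Down (2 + m) m-1 (trans (sym (+-suc (suc m) m-1)) 2m+1≡n) (m≤n⇒m≤o+n 4 ≤-refl) P? sperner)) ⟩
  2 + (card (P? ∩? Layer? n (suc m)) + card (Down? P? (2 + m)))      ≡⟨ x∙yz≈y∙xz +-commutativeSemigroup 2 (card (P? ∩? Layer? n (suc m))) _ ⟩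
  card (P? ∩? Layer? n (suc m)) + (2 + card (Down? P? (2 + m)))
    ≤⟨ +-monoʳ-≤ (card (P? ∩? Layer? n (suc m))) (∂-gains-2 (Down? P? (2 + m)) 2m+1≡n proj₁ below-X) ⟩
  card (P? ∩? Layer? n (suc m)) + card (∂? (Down? P? (2 + m)))       ≤⟨ layer+∂Down≤Down P? sperner ⟩
  card (Down? P? (suc m))                                            ≤⟨ card-mono (Down? P? (suc m)) (Layer? n (suc m)) proj₁ ⟩
  card (Layer? n (suc m))                                            ≡⟨ card-Layer n (suc m) ⟩
  n C suc m                                                          ∎
  where
  below-X : Satisfiable (Down P (2 + m))
  below-X with Z , Z⊆X , ∣Z∣ ← subset-of-size X (≤∧≢⇒< (P⊑AtLeast x) (∣X∣≢ ∘ sym)) = Z , ∣Z∣ , X , x , Z⊆X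

-- Complements and the lower half

ᶜ-involutive : (X : Subset n) → (X ᶜ) ᶜ ≡ X
ᶜ-involutive {n} = BooleanAlgebraProperties.¬-involutive (∪-∩-booleanAlgebra n)

∣ᶜ∣ : (X : Subset n) → ∣ X ∣ + ∣ X ᶜ ∣ ≡ n
∣ᶜ∣ X = trans (cong (∣ X ∣ +_) (∣∁p∣≡n∸∣p∣ X)) (m+[n∸m]≡n (∣p∣≤n X))

Sperner-ᶜ : Sperner P → Sperner (P ∘ _ᶜ)
Sperner-ᶜ sperner {X} {Y} x y X≢Y X⊆Y = sperner y x
  (λ eq → X≢Y (trans (sym (ᶜ-involutive X)) (trans (cong _ᶜ (sym eq)) (ᶜ-involutive Y))))
  (p⊆q⇒∁p⊇∁q X⊆Y)

Up : Family n → ℕ → Family n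
Up P j X = ∣ X ∣ ≡ j × ∃ λ Y → Y ∈ P × Y ⊆ X

Up? : Decidable P → ∀ j → Decidable (Up P j)
Up? P? j X = ∣ X ∣ ≟ j ×-dec anySubset? (λ Y → P? Y ×-dec Y ⊆? X)

-- Dual of `AtLeast≤Down`: complementation reverses inclusion and, as `n` is `m + suc m`, exchanges
-- levels `m` and `suc m`.
AtMost≤Up : m + suc m ≡ n → (P? : Decidable P) → Sperner P →
  card (P? ∩? AtMost? n m) ≤ card (Up? P? m)
AtMost≤Up {m = m} {n = n} {P = P} 2m+1≡n P? sperner = begin
  card (P? ∩? AtMost? n m)                   ≡⟨ card-ᶜ (P? ∩? AtMost? n m) ⟨
  card ((P? ∩? AtMost? n m) ∘ _ᶜ)            ≤⟨ card-mono ((P? ∩? AtMost? n m) ∘ _ᶜ) (Pᶜ? ∩? AtLeast? n (suc m)) large ⟩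
  card (Pᶜ? ∩? AtLeast? n (suc m))           ≤⟨ AtLeast≤Down (suc m) m 1+2m≡n (m≤n⇒m≤o+n 2 ≤-refl) Pᶜ? (Sperner-ᶜ sperner) ⟩
  card (Down? Pᶜ? (suc m))                   ≤⟨ card-mono (Down? Pᶜ? (suc m)) (Up? P? m ∘ _ᶜ) up ⟩
  card (Up? P? m ∘ _ᶜ)                       ≡⟨ card-ᶜ (Up? P? m) ⟩
  card (Up? P? m)                            ∎
  where
  Pᶜ? : Decidable (P ∘ _ᶜ)
  Pᶜ? = P? ∘ _ᶜ

  1+2m≡n : suc m + m ≡ n
  1+2m≡n = trans (sym (+-suc m m)) 2m+1≡n

  large : (P ∩ AtMost n m) ∘ _ᶜ ⊑ (P ∘ _ᶜ) ∩ AtLeast n (suc m)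
  large {X} (x , ∣Xᶜ∣≤m) = x , +-cancelʳ-≤ m (suc m) ∣ X ∣ (begin
    suc m + m        ≡⟨ trans 1+2m≡n (sym (∣ᶜ∣ X)) ⟩
    ∣ X ∣ + ∣ X ᶜ ∣  ≤⟨ +-monoʳ-≤ ∣ X ∣ ∣Xᶜ∣≤m ⟩
    ∣ X ∣ + m        ∎)

  up : Down (P ∘ _ᶜ) (suc m) ⊑ Up P m ∘ _ᶜ
  up {X} (∣X∣ , Y , y , X⊆Y) =
    +-cancelˡ-≡ (suc m) _ _ (trans (cong (_+ ∣ X ᶜ ∣) (sym ∣X∣)) (trans (∣ᶜ∣ X) (sym 1+2m≡n))) ,
    Y ᶜ , y , p⊆q⇒∁p⊇∁q X⊆Y

-- Sperner's bound and its equality case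

module _ {m n} {P : Family n} (2m+1≡n : m + suc m ≡ n) (P? : Decidable P) (sperner : Sperner P) where

  private
    1+2m≡n : suc m + m ≡ n
    1+2m≡n = trans (sym (+-suc m m)) 2m+1≡n

  card≤Up+Down : card P? ≤ card (Up? P? m) + card (Down? P? (suc m))
  card≤Up+Down = begin
    card P?                                                      ≤⟨ card-cover P? (P? ∩? AtMost? n m) (P? ∩? AtLeast? n (suc m)) split ⟩
    card (P? ∩? AtMost? n m) + card (P? ∩? AtLeast? n (suc m))
      ≤⟨ +-mono-≤ (AtMost≤Up 2m+1≡n P? sperner) (AtLeast≤Down (suc m) m 1+2m≡n (m≤n⇒m≤o+n 2 ≤-refl) P? sperner) ⟩
    card (Up? P? m) + card (Down? P? (suc m))                    ∎
    where
    split : ∀ {X} → X ∈ P → X ∈ P ∩ AtMost n m ⊎ X ∈ P ∩ AtLeast n (suc m)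
    split {X} x with ≤-<-connex ∣ X ∣ m
    ... | inj₁ ∣X∣≤m = inj₁ (x , ∣X∣≤m)
    ... | inj₂ m<∣X∣ = inj₂ (x , m<∣X∣)

  -- In `Y ⊆ Z ⋖ X ⊆ Y′` the antichain condition identifies `Y` and `Y′`, whence `X ⊆ Z`, against
  -- the sizes.
  ∇Up-disjoint-Down : X ∈ ∇ (Up P m) → ¬ X ∈ Down P (suc m)
  ∇Up-disjoint-Down (Z , (∣Z∣ , Y , y , Y⊆Z) , c) (∣X∣ , Y′ , y′ , X⊆Y′)
    with refl ← Sperner⇒≡ sperner y y′ (⊆-trans Y⊆Z (⊆-trans (⋖⇒⊆ c) X⊆Y′))
    = <⇒≱ (≤-reflexive (sym (⋖⇒∣∣ c))) (p⊆q⇒∣p∣≤∣q∣ (⊆-trans X⊆Y′ Y⊆Z))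

  ∇Up+Down≤C : card (∇? (Up? P? m)) + card (Down? P? (suc m)) ≤ n C suc m
  ∇Up+Down≤C = begin
    card (∇? (Up? P? m)) + card (Down? P? (suc m))
      ≤⟨ card-disjoint (∇? (Up? P? m)) (Down? P? (suc m)) (Layer? n (suc m)) ∇Up-disjoint-Down (∇-layer proj₁) proj₁ ⟩
    card (Layer? n (suc m))                         ≡⟨ card-Layer n (suc m) ⟩
    n C suc m                                       ∎

  Sperner-bound : card P? ≤ n C suc m
  Sperner-bound = begin
    card P?                                         ≤⟨ card≤Up+Down ⟩
    card (Up? P? m) + card (Down? P? (suc m))       ≤⟨ +-monoˡ-≤ _ (∇-grows (Up? P? m) 2m+1≡n proj₁) ⟩
    card (∇? (Up? P? m)) + card (Down? P? (suc m))  ≤⟨ ∇Up+Down≤C ⟩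
    n C suc m                                       ∎

  -- Equality leaves no slack in `∇-grows`, so `Up P m` is closed under exchanges and a single set
  -- in it spreads over the layer by `swap-connected`.
  Up-none-or-all : n C suc m ≤ card P? → (∀ X → ¬ X ∈ Up P m) ⊎ (Layer n m ⊑ Up P m)
  Up-none-or-all C≤P with anySubset? (Up? P? m)
  ... | no none = inj₁ (λ X x → none (X , x))
  ... | yes (X , x) = inj₂ (λ {Y} ∣Y∣ → swap-connected (Up P m) (∇-tight⇒closed (Up? P? m) 2m+1≡n proj₁ tight)
                              X Y (trans (proj₁ x) (sym ∣Y∣)) x)
    where
    tight : card (∇? (Up? P? m)) ≤ card (Up? P? m)
    tight = +-cancelʳ-≤ (card (Down? P? (suc m))) _ _ (≤-trans ∇Up+Down≤C (≤-trans C≤P card≤Up+Down))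

  -- A member of size at most `m` would extend to an `m`-set, obtained as the complement of a
  -- `suc m`-subset of its complement.
  Up-empty⇒AtLeast : (∀ X → ¬ X ∈ Up P m) → P ⊑ AtLeast n (suc m)
  Up-empty⇒AtLeast none {X} x = ≰⇒> λ ∣X∣≤m →
    let Z , Z⊆Xᶜ , ∣Z∣ = subset-of-size (X ᶜ) (+-cancelˡ-≤ m _ _ (begin
          m + suc m        ≡⟨ trans 2m+1≡n (sym (∣ᶜ∣ X)) ⟩
          ∣ X ∣ + ∣ X ᶜ ∣  ≤⟨ +-monoˡ-≤ _ ∣X∣≤m ⟩
          m + ∣ X ᶜ ∣      ∎))
    in none (Z ᶜ)
      ( +-cancelˡ-≡ (suc m) _ _ (trans (cong (_+ ∣ Z ᶜ ∣) (sym ∣Z∣)) (trans (∣ᶜ∣ Z) (sym 1+2m≡n)))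
      , X , x , subst (_⊆ Z ᶜ) (ᶜ-involutive X) (p⊆q⇒∁p⊇∁q Z⊆Xᶜ))

-- Ensures that a family of size `M ∸ 1` is nonempty. The 2 is the gain of `∂-gains-2` on the whole
-- layer `2 + m`.
2≤C : .{{_ : NonZero m}} → suc m + m ≡ n → 2 ≤ n C suc m
2≤C {m = m@(suc m-1)} {n = n} 1+2m≡n = begin
  2                                ≤⟨ m≤m+n 2 _ ⟩
  2 + card (Layer? n (2 + m))      ≤⟨ ∂-gains-2 (Layer? n (2 + m)) 1+2m≡n (λ eq → eq) top ⟩
  card (∂? (Layer? n (2 + m)))     ≤⟨ card-mono (∂? (Layer? n (2 + m))) (Layer? n (suc m)) (∂-layer (λ eq → eq)) ⟩
  card (Layer? n (suc m))          ≡⟨ card-Layer n (suc m) ⟩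
  n C suc m                        ∎
  where
  2+m≤n : 2 + m ≤ ∣ ⊤ {n} ∣
  2+m≤n = subst (2 + m ≤_) (trans (trans (sym (+-suc (suc m) m-1)) 1+2m≡n) (sym (∣⊤∣≡n n))) (m≤m+n (2 + m) m-1)

  top : Satisfiable (Layer n (2 + m))
  top with Z , _ , ∣Z∣ ← subset-of-size ⊤ 2+m≤n = Z , ∣Z∣

-- Cross-intersecting families

CrossIntersecting-sym : CrossIntersecting P Q → CrossIntersecting Q P
CrossIntersecting-sym cross {X} {Y} x y = subst Nonempty (∩-comm Y X) (cross y x)

-- Otherwise the complement of `Y` contains a `j`-set, and the member of `P` inside that set misses
-- `Y`.
cross-large : CrossIntersecting P Q → Layer n j ⊑ Up P j → Y ∈ Q → n < j + ∣ Y ∣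
cross-large {n} {j = j} {Y = Y} cross all y = ≰⇒> λ j+∣Y∣≤n →
  let Z , Z⊆Yᶜ , ∣Z∣     = subset-of-size (Y ᶜ) (+-cancelʳ-≤ ∣ Y ∣ j _
                             (subst (j + ∣ Y ∣ ≤_) (sym (trans (+-comm ∣ Y ᶜ ∣ ∣ Y ∣) (∣ᶜ∣ Y))) j+∣Y∣≤n))
      _ , X , x , X⊆Z   = all ∣Z∣
      i , i∈X∩Y         = cross x y
      i∈X , i∈Y         = x∈p∩q⁻ X Y i∈X∩Y
  in x∈∁p⇒x∉p (Z⊆Yᶜ (X⊆Z i∈X)) i∈Y

module _ .{{_ : NonZero m}} (2m+1≡n : m + suc m ≡ n) where

  private
    1+2m≡n : suc m + m ≡ n
    1+2m≡n = trans (sym (+-suc m m)) 2m+1≡n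

    M : ℕ
    M = n C suc m

    1≤M : 1 ≤ M
    1≤M = <⇒≤ (2≤C 1+2m≡n)

  -- A member off the level would, by `upper-half-gap`, leave at most `M - 2` members.
  near-maximum⇒Layer : (P? : Decidable P) → Sperner P → P ⊑ AtLeast n (suc m) → M ∸ 1 ≤ card P? → P ⊑ Layer n (suc m)
  near-maximum⇒Layer P? sperner P⊑AtLeast M-1≤P {X} x with Layer? n (suc m) X
  ... | yes ∣X∣ = ∣X∣
  ... | no ∣X∣≢ = contradiction (upper-half-gap 1+2m≡n P? sperner P⊑AtLeast x ∣X∣≢)
    (<⇒≱ (s≤s (≤-trans (m≤n+m∸n M 1) (s≤s M-1≤P))))

  extremal-pair : (P? : Decidable P) (Q? : Decidable Q) → Sperner P → Sperner Q → CrossIntersecting P Q →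
    card P? ≡ M → card Q? ≡ M ∸ 1 → P ≐ Layer n (suc m) × Q ⊂ Layer n (suc m)
  extremal-pair {P = P} {Q = Q} P? Q? spernerP spernerQ cross ∣P∣ ∣Q∣
    with Up-none-or-all 2m+1≡n P? spernerP (≤-reflexive (sym ∣P∣))
  ... | inj₁ none = (P⊑Layer , Layer⊑P) , (Q⊑Layer , Layer⋢Q)
    where
    P⊑Layer : P ⊑ Layer n (suc m)
    P⊑Layer = near-maximum⇒Layer P? spernerP (Up-empty⇒AtLeast 2m+1≡n P? spernerP none)
      (≤-trans (m∸n≤m M 1) (≤-reflexive (sym ∣P∣)))

    Layer⊑P : Layer n (suc m) ⊑ P
    Layer⊑P = card-squeeze P? (Layer? n (suc m)) P⊑Layer (≤-reflexive (trans (card-Layer n (suc m)) (sym ∣P∣)))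

    Q⊑Layer : Q ⊑ Layer n (suc m)
    Q⊑Layer = near-maximum⇒Layer Q? spernerQ
      -- `P` is now the full layer, so each set of level `suc m` is its own witness in
      -- `Up P (suc m)`; `cross-large` gives `suc m + suc m ≤ suc m + ∣ Y ∣`.
      (λ {Y} y → +-cancelˡ-≤ (suc m) _ _ (subst (_≤ suc m + ∣ Y ∣) (trans (cong suc (sym 1+2m≡n)) (sym (+-suc (suc m) m)))
        (cross-large cross (λ {X} ∣X∣ → ∣X∣ , X , Layer⊑P ∣X∣ , ⊆-refl) y)))
      (≤-reflexive (sym ∣Q∣))

    Layer⋢Q : ¬ Layer n (suc m) ⊑ Q
    Layer⋢Q Layer⊑Q = <⇒≱ (∸-monoʳ-< (s≤s z≤n) 1≤M) (begin
      M                        ≡⟨ card-Layer n (suc m) ⟨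
      card (Layer? n (suc m))  ≤⟨ card-mono (Layer? n (suc m)) Q? Layer⊑Q ⟩
      card Q?                  ≡⟨ ∣Q∣ ⟩
      M ∸ 1                    ∎)
  -- Cross-intersection puts `Q` on levels from `2 + m` on, while its size puts it on level `suc m`.
  -- So `Q` is empty, although `M ∸ 1` is positive.
  ... | inj₂ all = contradiction ∣Q∣ (λ ∣Q∣ → <⇒≢ (m<n⇒0<n∸m (2≤C 1+2m≡n)) (trans (sym (card-∅ Q? Q-empty)) ∣Q∣))
    where
    Q-large : Q ⊑ AtLeast n (2 + m)
    Q-large {Y} y = +-cancelˡ-≤ m _ _ (subst (_≤ m + ∣ Y ∣)
      (trans (cong suc (sym 2m+1≡n)) (sym (+-suc m (suc m)))) (cross-large cross all y))

    Q-empty : ∀ Y → ¬ Y ∈ Q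
    Q-empty Y y = <⇒≢ (Q-large y)
      (sym (near-maximum⇒Layer Q? spernerQ (<⇒≤ ∘ Q-large) (≤-reflexive (sym ∣Q∣)) y))

-- Arithmetic of the extremal sum and conclusion

near-extremal-sum : ∀ {a b c} → 0 < c → a ≤ c → b ≤ c → a + b ≡ 2 * c ∸ 1 →
  (a ≡ c × b ≡ c ∸ 1) ⊎ (b ≡ c × a ≡ c ∸ 1)
near-extremal-sum {a} {b} {suc c} _ a≤1+c b≤1+c sum with m≤n⇒m<n∨m≡n a≤1+c
-- For a successor, `2 * suc c ∸ 1` computes to `c + (suc c + 0)`, so the truncated subtraction
-- disappears.
... | inj₂ refl = inj₁ (refl , +-cancelˡ-≡ (suc c) b c (trans sum (trans (cong (c +_) (+-identityʳ (suc c))) (+-suc c c))))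
... | inj₁ (s≤s a≤c) = inj₂ (b≡1+c , +-cancelʳ-≡ (suc c) a c (trans (cong (a +_) (sym b≡1+c)) sum′))
  where
  sum′ : a + b ≡ c + suc c
  sum′ = trans sum (cong (c +_) (+-identityʳ (suc c)))
  b≡1+c : b ≡ suc c
  b≡1+c = ≤-antisym b≤1+c (+-cancelˡ-≤ c _ _ (≤-trans (≤-reflexive (sym sum′)) (+-monoˡ-≤ b a≤c)))

c+[c∸1]≡2c∸1 : ∀ {c} → 0 < c → c + (c ∸ 1) ≡ 2 * c ∸ 1
c+[c∸1]≡2c∸1 {c} 0<c = trans (sym (+-∸-assoc c 0<c)) (cong (λ z → c + z ∸ 1) (sym (+-identityʳ c)))

card-≐-Layer : (P? : Decidable P) → P ≐ Layer n k → card P? ≡ n C k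
card-≐-Layer {n = n} {k = k} P? (P⊑Layer , Layer⊑P) = trans
  (≤-antisym (card-mono P? (Layer? n k) P⊑Layer) (card-mono (Layer? n k) P? Layer⊑P)) (card-Layer n k)

odd⇒⌈n/2⌉≡1+⌊n/2⌋ : ∀ n → ¬ (2 ∣ n) → ⌈ n /2⌉ ≡ suc ⌊ n /2⌋
odd⇒⌈n/2⌉≡1+⌊n/2⌋ zero          2∤n = contradiction (divides 0 refl) 2∤n
odd⇒⌈n/2⌉≡1+⌊n/2⌋ (suc zero)    2∤n = refl
odd⇒⌈n/2⌉≡1+⌊n/2⌋ (suc (suc n)) 2∤n = cong suc
  (odd⇒⌈n/2⌉≡1+⌊n/2⌋ n (λ { (divides q eq) → 2∤n (divides (suc q) (cong (2 +_) eq)) }))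

-- The hypotheses are symmetric in the two families, so either one can be the full layer; hence the
-- disjunction.
theorem1p5 : (n : ℕ) → 3 ≤ n → ¬ (2 ∣ n) →
    (𝓐 𝓑 : Family n) (𝓐? : Decidable 𝓐) (𝓑? : Decidable 𝓑) →
    Sperner 𝓐 → Sperner 𝓑 → CrossIntersecting 𝓐 𝓑 →
    (card 𝓐? + card 𝓑? ≡ 2 * (n C ⌈ n /2⌉) ∸ 1)
    ⇔
    ( (𝓐 ≐ Layer n ⌈ n /2⌉ × 𝓑 ⊂ Layer n ⌈ n /2⌉ × card 𝓑? ≡ (n C ⌈ n /2⌉) ∸ 1)
    ⊎ (𝓑 ≐ Layer n ⌈ n /2⌉ × 𝓐 ⊂ Layer n ⌈ n /2⌉ × card 𝓐? ≡ (n C ⌈ n /2⌉) ∸ 1))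
theorem1p5 n 3≤n 2∤n 𝓐 𝓑 𝓐? 𝓑? sperner𝓐 sperner𝓑 cross
  rewrite odd⇒⌈n/2⌉≡1+⌊n/2⌋ n 2∤n = mk⇔ forward backward
  where
  h : ℕ
  h = ⌊ n /2⌋

  -- `3 ≤ n` gives `1 ≤ h`, the nonzero `m` that `∂-gains-2` and the results built on it ask for.
  instance
    h≢0 : NonZero h
    h≢0 = >-nonZero (⌊n/2⌋-mono 3≤n)

  2h+1≡n : h + suc h ≡ n
  2h+1≡n = trans (cong (h +_) (sym (odd⇒⌈n/2⌉≡1+⌊n/2⌋ n 2∤n))) (⌊n/2⌋+⌈n/2⌉≡n n)

  L : Family n
  L = Layer n (suc h)

  c : ℕ
  c = n C suc h

  0<c : 0 < c
  0<c = <⇒≤ (2≤C (trans (sym (+-suc h h)) 2h+1≡n))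

  forward : card 𝓐? + card 𝓑? ≡ 2 * c ∸ 1 →
    (𝓐 ≐ L × 𝓑 ⊂ L × card 𝓑? ≡ c ∸ 1) ⊎ (𝓑 ≐ L × 𝓐 ⊂ L × card 𝓐? ≡ c ∸ 1)
  forward sum with near-extremal-sum 0<c (Sperner-bound 2h+1≡n 𝓐? sperner𝓐) (Sperner-bound 2h+1≡n 𝓑? sperner𝓑) sum
  ... | inj₁ (∣𝓐∣ , ∣𝓑∣) =
    let 𝓐≐L , 𝓑⊂L = extremal-pair 2h+1≡n 𝓐? 𝓑? sperner𝓐 sperner𝓑 cross ∣𝓐∣ ∣𝓑∣
    in inj₁ (𝓐≐L , 𝓑⊂L , ∣𝓑∣)
  ... | inj₂ (∣𝓑∣ , ∣𝓐∣) =
    let 𝓑≐L , 𝓐⊂L = extremal-pair 2h+1≡n 𝓑? 𝓐? sperner𝓑 sperner𝓐 (CrossIntersecting-sym cross) ∣𝓑∣ ∣𝓐∣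
    in inj₂ (𝓑≐L , 𝓐⊂L , ∣𝓐∣)

  backward : (𝓐 ≐ L × 𝓑 ⊂ L × card 𝓑? ≡ c ∸ 1) ⊎ (𝓑 ≐ L × 𝓐 ⊂ L × card 𝓐? ≡ c ∸ 1) →
    card 𝓐? + card 𝓑? ≡ 2 * c ∸ 1
  backward (inj₁ (𝓐≐L , _ , ∣𝓑∣)) = trans (cong₂ _+_ (card-≐-Layer 𝓐? 𝓐≐L) ∣𝓑∣) (c+[c∸1]≡2c∸1 0<c)
  backward (inj₂ (𝓑≐L , _ , ∣𝓐∣)) =
    trans (+-comm (card 𝓐?) _) (trans (cong₂ _+_ (card-≐-Layer 𝓑? 𝓑≐L) ∣𝓐∣) (c+[c∸1]≡2c∸1 0<c))
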